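{- Let $\ell$ be an odd multiple of $3$. Let $S\subseteq D_{8\ell+6}\setminus\{e\}$ with $|S|=8\ell+4$, and let $x$ be the non-identity element of $D_{8\ell+6}$ not in $S$. If $x$ has order $(4\ell+3)/3$, then $D_{8\ell+6}$ has an $S$-sequencing.
   Context: $D_{2m}=\langle u,v : u^m=e=v^2,\ vu=u^{m-1}v\rangle$ is the dihedral group of order $2m$. For $S\subseteq G\setminus\{e\}$ with $|S|=k$, an $S$-sequencing of $G$ is an ordering $(g_1,\dots,g_k)$ of the elements of $S$ such that the partial products $h_0=e$, $h_i=g_1\cdots g_i$ ($1\le i\le k$) are pairwise distinct. -}

module Defs where

open import Algebra.Bundles using (Group; AbelianGroup)
import Algebra.Definitions.RawMonoid as RawMonoidDefs
import Algebra.Properties.AbelianGroup as AbelianGroupProperties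
open import Data.Fin.Base using (Fin; toℕ)
open import Data.Fin.Properties using (toℕ-injective; toℕ-fromℕ<; toℕ<n; toℕ≤n)
open import Data.List.Base using (List; length)
import Data.List.Membership.Setoid as Membership
import Data.List.Relation.Unary.Unique.Setoid as Uniqueness
open import Data.List.Scans.Base using (scanl)
open import Data.Nat.Base
  using (ℕ; zero; suc; _+_; _∸_; _≤_; _<_; NonZero; >-nonZero⁻¹)
open import Data.Nat.DivMod
  using (_%_; _mod_; m%n<n; n%n≡0; %-distribˡ-+; m<n⇒m%n≡m)
open import Data.Nat.Properties using (+-assoc; +-comm; m∸n+n≡m)
open import Data.Product.Base using (_×_; _,_; ∃-syntax)
open import Data.Sum.Base using (_⊎_; inj₁; inj₂)
open import Function.Bundles using (_⇔_)
open import Level using (Level; 0ℓ; _⊔_)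
open import Relation.Binary.PropositionalEquality
  using (_≡_; refl; sym; trans; cong; cong₂; isEquivalence; module ≡-Reasoning)
open import Relation.Unary using (Pred; _∈_)

module GroupDefs {c ℓ : Level} (G : Group c ℓ) where

  open Group G
  open Membership setoid using () renaming (_∈_ to _∈ˡ_)
  open Uniqueness setoid using (Unique)

  infixr 8 _^_

  _^_ : Carrier → ℕ → Carrier
  g ^ n = RawMonoidDefs._×_ rawMonoid n g

  HasOrder : Carrier → ℕ → Set ℓ
  HasOrder g n =
    0 < n × g ^ n ≈ ε × (∀ k → 0 < k → g ^ k ≈ ε → n ≤ k)

  IsOrdering : {p : Level} → Pred Carrier p → List Carrier → Set (c ⊔ ℓ ⊔ p)
  IsOrdering S gs = Unique gs × (∀ g → g ∈ˡ gs ⇔ g ∈ S)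

  HasCardinality : {p : Level} → Pred Carrier p → ℕ → Set (c ⊔ ℓ ⊔ p)
  HasCardinality S k = ∃[ gs ] (IsOrdering S gs × length gs ≡ k)

  -- The list h₀ , h₁ , … , hₖ, starting with h₀ = ε.
  partialProducts : List Carrier → List Carrier
  partialProducts = scanl _∙_ ε

  IsSequencing : {p : Level} → Pred Carrier p → List Carrier → Set (c ⊔ ℓ ⊔ p)
  IsSequencing S gs = IsOrdering S gs × Unique (partialProducts gs)

module ModularArithmetic (m : ℕ) .{{_ : NonZero m}} where

  infixl 6 _⊕_ _⊖_

  _⊕_ : Fin m → Fin m → Fin m
  i ⊕ j = (toℕ i + toℕ j) mod m

  𝟘 : Fin m
  𝟘 = 0 mod m

  ⊝_ : Fin m → Fin m
  ⊝ i = (m ∸ toℕ i) mod m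

  _⊖_ : Fin m → Fin m → Fin m
  i ⊖ j = i ⊕ (⊝ j)

  open ≡-Reasoning

  toℕ-mod : ∀ a → toℕ (a mod m) ≡ a % m
  toℕ-mod a = toℕ-fromℕ< (m%n<n a m)

  mod-cong : ∀ {a b} → a % m ≡ b % m → a mod m ≡ b mod m
  mod-cong {a} {b} eq =
    toℕ-injective (trans (toℕ-mod a) (trans eq (sym (toℕ-mod b))))

  mod-toℕ : ∀ i → toℕ i mod m ≡ i
  mod-toℕ i = toℕ-injective (trans (toℕ-mod (toℕ i)) (m<n⇒m%n≡m (toℕ<n i)))

  mod-⊕ : ∀ a b → (a mod m) ⊕ (b mod m) ≡ (a + b) mod m
  mod-⊕ a b = mod-cong (begin
    (toℕ (a mod m) + toℕ (b mod m)) % m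
      ≡⟨ cong₂ (λ x y → (x + y) % m) (toℕ-mod a) (toℕ-mod b) ⟩
    (a % m + b % m) % m
      ≡⟨ %-distribˡ-+ a b m ⟨
    (a + b) % m ∎)

  ⊕-comm : ∀ i j → i ⊕ j ≡ j ⊕ i
  ⊕-comm i j = cong (_mod m) (+-comm (toℕ i) (toℕ j))

  ⊕-assoc : ∀ i j k → (i ⊕ j) ⊕ k ≡ i ⊕ (j ⊕ k)
  ⊕-assoc i j k = begin
    (i ⊕ j) ⊕ k
      ≡⟨ cong ((i ⊕ j) ⊕_) (mod-toℕ k) ⟨
    (i ⊕ j) ⊕ (toℕ k mod m)
      ≡⟨ mod-⊕ (toℕ i + toℕ j) (toℕ k) ⟩
    (toℕ i + toℕ j + toℕ k) mod m
      ≡⟨ cong (_mod m) (+-assoc (toℕ i) (toℕ j) (toℕ k)) ⟩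
    (toℕ i + (toℕ j + toℕ k)) mod m
      ≡⟨ mod-⊕ (toℕ i) (toℕ j + toℕ k) ⟨
    (toℕ i mod m) ⊕ (j ⊕ k)
      ≡⟨ cong (_⊕ (j ⊕ k)) (mod-toℕ i) ⟩
    i ⊕ (j ⊕ k) ∎

  ⊕-identityˡ : ∀ i → 𝟘 ⊕ i ≡ i
  ⊕-identityˡ i = begin
    𝟘 ⊕ i                ≡⟨ cong (𝟘 ⊕_) (mod-toℕ i) ⟨
    𝟘 ⊕ (toℕ i mod m)    ≡⟨ mod-⊕ 0 (toℕ i) ⟩
    toℕ i mod m          ≡⟨ mod-toℕ i ⟩
    i                    ∎

  m-mod-m : m mod m ≡ 𝟘
  m-mod-m = mod-cong (trans (n%n≡0 m) (sym (m<n⇒m%n≡m (>-nonZero⁻¹ m))))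

  ⊕-inverseˡ : ∀ i → (⊝ i) ⊕ i ≡ 𝟘
  ⊕-inverseˡ i = begin
    (⊝ i) ⊕ i                ≡⟨ cong ((⊝ i) ⊕_) (mod-toℕ i) ⟨
    (⊝ i) ⊕ (toℕ i mod m)    ≡⟨ mod-⊕ (m ∸ toℕ i) (toℕ i) ⟩
    (m ∸ toℕ i + toℕ i) mod m
      ≡⟨ cong (_mod m) (m∸n+n≡m (toℕ≤n i)) ⟩
    m mod m                  ≡⟨ m-mod-m ⟩
    𝟘                        ∎

  ⊕-abelianGroup : AbelianGroup 0ℓ 0ℓ
  ⊕-abelianGroup = record
    { Carrier = Fin m
    ; _≈_ = _≡_
    ; _∙_ = _⊕_
    ; ε = 𝟘
    ; _⁻¹ = ⊝_
    ; isAbelianGroup = record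
      { isGroup = record
        { isMonoid = record
          { isSemigroup = record
            { isMagma = record
              { isEquivalence = isEquivalence ; ∙-cong = cong₂ _⊕_ }
            ; assoc = ⊕-assoc }
          ; identity = ⊕-identityˡ
                     , λ i → trans (⊕-comm i 𝟘) (⊕-identityˡ i) }
        ; inverse = ⊕-inverseˡ
                  , λ i → trans (⊕-comm i (⊝ i)) (⊕-inverseˡ i)
        ; ⁻¹-cong = cong ⊝_ }
      ; comm = ⊕-comm } }

-- The normal forms of the dihedral group of order 2m: rot i is uⁱ, ref i is uⁱv.
data Dihedral (m : ℕ) : Set where
  rot ref : Fin m → Dihedral m

module DihedralGroup (m : ℕ) .{{_ : NonZero m}} where

  open ModularArithmetic m
  open AbelianGroup ⊕-abelianGroup using (identityʳ; inverseʳ)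
  open AbelianGroupProperties ⊕-abelianGroup
    using (⁻¹-involutive; inverseˡ-unique; ε⁻¹≈ε; ⁻¹-∙-comm)
  open ≡-Reasoning

  infixl 7 _·_

  -- Since v uʲ = u⁻ʲ v.
  _·_ : Dihedral m → Dihedral m → Dihedral m
  rot i · rot j = rot (i ⊕ j)
  rot i · ref j = ref (i ⊕ j)
  ref i · rot j = ref (i ⊖ j)
  ref i · ref j = rot (i ⊖ j)

  e u v : Dihedral m
  e = rot 𝟘
  u = rot (1 mod m)
  v = ref 𝟘

  inv : Dihedral m → Dihedral m
  inv (rot i) = rot (⊝ i)
  inv (ref i) = ref i

  ⊖-⊕ : ∀ i j k → (i ⊖ j) ⊖ k ≡ i ⊖ (j ⊕ k)
  ⊖-⊕ i j k = trans (⊕-assoc i (⊝ j) (⊝ k)) (cong (i ⊕_) (⁻¹-∙-comm j k))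

  ⊖-⊖ : ∀ i j k → (i ⊖ j) ⊕ k ≡ i ⊖ (j ⊖ k)
  ⊖-⊖ i j k = begin
    (i ⊖ j) ⊕ k        ≡⟨ cong ((i ⊖ j) ⊕_) (⁻¹-involutive k) ⟨
    (i ⊖ j) ⊖ (⊝ k)    ≡⟨ ⊖-⊕ i j (⊝ k) ⟩
    i ⊖ (j ⊖ k)        ∎

  ·-assoc : ∀ x y z → (x · y) · z ≡ x · (y · z)
  ·-assoc (rot i) (rot j) (rot k) = cong rot (⊕-assoc i j k)
  ·-assoc (rot i) (rot j) (ref k) = cong ref (⊕-assoc i j k)
  ·-assoc (rot i) (ref j) (rot k) = cong ref (⊕-assoc i j (⊝ k))
  ·-assoc (rot i) (ref j) (ref k) = cong rot (⊕-assoc i j (⊝ k))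
  ·-assoc (ref i) (rot j) (rot k) = cong ref (⊖-⊕ i j k)
  ·-assoc (ref i) (rot j) (ref k) = cong rot (⊖-⊕ i j k)
  ·-assoc (ref i) (ref j) (rot k) = cong rot (⊖-⊖ i j k)
  ·-assoc (ref i) (ref j) (ref k) = cong ref (⊖-⊖ i j k)

  ·-identityˡ : ∀ x → e · x ≡ x
  ·-identityˡ (rot i) = cong rot (⊕-identityˡ i)
  ·-identityˡ (ref i) = cong ref (⊕-identityˡ i)

  ·-identityʳ : ∀ x → x · e ≡ x
  ·-identityʳ (rot i) = cong rot (identityʳ i)
  ·-identityʳ (ref i) = cong ref (trans (cong (i ⊕_) ε⁻¹≈ε) (identityʳ i))

  ·-inverseˡ : ∀ x → inv x · x ≡ e
  ·-inverseˡ (rot i) = cong rot (⊕-inverseˡ i)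
  ·-inverseˡ (ref i) = cong rot (inverseʳ i)

  ·-inverseʳ : ∀ x → x · inv x ≡ e
  ·-inverseʳ (rot i) = cong rot (inverseʳ i)
  ·-inverseʳ (ref i) = cong rot (inverseʳ i)

  group : Group 0ℓ 0ℓ
  group = record
    { Carrier = Dihedral m
    ; _≈_ = _≡_
    ; _∙_ = _·_
    ; ε = e
    ; _⁻¹ = inv
    ; isGroup = record
      { isMonoid = record
        { isSemigroup = record
          { isMagma = record
            { isEquivalence = isEquivalence ; ∙-cong = cong₂ _·_ }
          ; assoc = ·-assoc }
        ; identity = ·-identityˡ , ·-identityʳ }
      ; inverse = ·-inverseˡ , ·-inverseʳ
      ; ⁻¹-cong = cong inv } }

  -- The defining relations hold and u, v generate; as Dihedral m has 2m
  -- elements, this is the group presented by those relations.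

  open GroupDefs group using (_^_)

  u^ : ∀ n → u ^ n ≡ rot (n mod m)
  u^ zero    = refl
  u^ (suc n) = trans (cong (u ·_) (u^ n)) (cong rot (mod-⊕ 1 n))

  u^m≡e : u ^ m ≡ e
  u^m≡e = trans (u^ m) (cong rot m-mod-m)

  v²≡e : v · v ≡ e
  v²≡e = cong rot (inverseʳ 𝟘)

  vu≡u^[m-1]v : v · u ≡ u ^ (m ∸ 1) · v
  vu≡u^[m-1]v = begin
    ref (𝟘 ⊖ 1 mod m)              ≡⟨ cong ref (⊕-identityˡ _) ⟩
    ref (⊝ (1 mod m))              ≡⟨ cong ref (inverseˡ-unique _ _ sum≡𝟘) ⟨
    ref ((m ∸ 1) mod m)            ≡⟨ cong ref (identityʳ _) ⟨
    rot ((m ∸ 1) mod m) · v        ≡⟨ cong (_· v) (u^ (m ∸ 1)) ⟨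
    u ^ (m ∸ 1) · v                ∎
    where
    sum≡𝟘 : (m ∸ 1) mod m ⊕ 1 mod m ≡ 𝟘
    sum≡𝟘 = begin
      (m ∸ 1) mod m ⊕ 1 mod m      ≡⟨ mod-⊕ (m ∸ 1) 1 ⟩
      (m ∸ 1 + 1) mod m            ≡⟨ cong (_mod m) (m∸n+n≡m (>-nonZero⁻¹ m)) ⟩
      m mod m                      ≡⟨ m-mod-m ⟩
      𝟘                            ∎

  generated : ∀ g → (∃[ n ] g ≡ u ^ n) ⊎ (∃[ n ] g ≡ u ^ n · v)
  generated (rot i) = inj₁ (toℕ i , sym (trans (u^ (toℕ i)) (cong rot (mod-toℕ i))))
  generated (ref i) = inj₂ (toℕ i , sym (trans (cong (_· v) (u^ (toℕ i)))
    (cong ref (trans (identityʳ _) (mod-toℕ i)))))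

{-# OPTIONS --safe #-}

-- If the steps g⁻¹h of a path through all but one of the elements of the group
-- meet every element other than e and x, they form the required sequencing.
-- Write R z = uᶻ and F z = uᶻv. A step R y → R z is R (z - y), a step F y → F z
-- is R (y - z), and a step between R y and F z is F (z - y) in both directions.
-- For m = 4ℓ + 3 the path
--   R 0 ,
--   R 3 , R -1 , R 4 , R -2 , … , R (ℓ + 2) ,
--   F 0 , F -1 ,
--   F 1 , R -ℓ , F 2 , R -(ℓ + 1) , … , F (ℓ + 1) ,
--   R 1 ,
--   R (2ℓ + 3) , F (ℓ + 2) , R (2ℓ + 2) , F (ℓ + 3) , … , R (ℓ + 3) ,
--   F (2ℓ + 2) , F -2 , F (2ℓ + 3) , F -3 , … , F (3ℓ + 1) , F (3ℓ + 2)
-- misses only R 2, and its steps miss only e and R (2ℓ). Since 2 · 2ℓ ≡ - 3, the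
-- latter has order m / 3 when 3 divides ℓ. Any other element of order m / 3 is
-- reached by multiplying all exponents by a unit modulo m. By counting, it is
-- enough to show that path and steps cover what they should.
module Submission where

open import Defs
open import Algebra.Bundles using (Group; AbelianGroup)
import Algebra.Properties.AbelianGroup as AbelianGroupProperties
open import Data.Fin.Base using (Fin; toℕ)
import Data.Fin.Properties as Fin
open import Data.Integer.Base using (ℤ; +_; -[1+_]; -_; 1ℤ)
  renaming (_+_ to _+ℤ_; _-_ to _-ℤ_; _⊖_ to _⊖ℤ_)
import Data.Integer.Properties as ℤ
open import Data.Integer.Tactic.RingSolver using () renaming (solve-∀ to solveℤ)
open import Data.List.Base using (List; []; _∷_; _++_; length; map; allFin)
open import Data.List.Membership.Propositional renaming (_∈_ to _∈ˡ_; _∉_ to _∉ˡ_)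
  using ()
open import Data.List.Membership.Propositional.Properties
  using (∈-++⁺ˡ; ∈-++⁺ʳ; ∈-++⁻; ∈-map⁺; ∈-map⁻; ∈-allFin; ∈-∃++)
open import Data.List.Properties using (length-++; length-map; length-tabulate)
open import Data.List.Relation.Binary.Subset.Propositional using (_⊆_)
open import Data.List.Relation.Unary.All as All using ()
open import Data.List.Relation.Unary.All.Properties using (All¬⇒¬Any; ¬Any⇒All¬)
open import Data.List.Relation.Unary.AllPairs as AllPairs using ([]; _∷_)
open import Data.List.Relation.Unary.Any using (here; there; any?)
open import Data.List.Relation.Unary.Unique.Propositional using (Unique)
open import Data.List.Relation.Unary.Unique.Propositional.Properties
  using (++⁺; map⁺; allFin⁺; Unique[x∷xs]⇒x∉xs)
open import Data.List.Scans.Base using (scanl)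
open import Data.Nat.Base hiding (_^_)
open import Data.Nat.Coprimality using (Coprime; coprime-Bézout; coprime-divisor)
open import Data.Nat.Divisibility
open import Data.Nat.DivMod
open import Data.Nat.GCD using (module Bézout)
open import Data.Nat.Primality using (prime?; prime⇒irreducible)
open import Data.Nat.Properties
open import Data.Nat.Tactic.RingSolver using (solve-∀)
open import Data.Product.Base using (_×_; _,_; ∃-syntax; proj₁; proj₂)
open import Data.Sum.Base using (inj₁; inj₂)
open import Function.Base using (_∘_; id; _$_)
open import Function.Bundles using (mk⇔; Equivalence)
open import Level using (0ℓ)
open import Relation.Binary.Definitions using (DecidableEquality)
open import Relation.Binary.PropositionalEquality
open import Relation.Nullary using (yes; no; contradiction)
open import Relation.Nullary.Decidable using (from-yes; map′)
open import Relation.Nullary.Negation.Core using (¬_)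
open import Relation.Unary using (Pred; _∈_; _∉_)

-- Counting in lists without repetition.

private variable
  A : Set
  xs ys us : List A

∈-delete : ∀ {x y : A} as {bs} → y ∈ˡ as ++ x ∷ bs → y ≢ x → y ∈ˡ as ++ bs
∈-delete as y∈ y≢x with ∈-++⁻ as y∈
... | inj₁ y∈as = ∈-++⁺ˡ y∈as
... | inj₂ (here y≡x) = contradiction y≡x y≢x
... | inj₂ (there y∈bs) = ∈-++⁺ʳ as y∈bs

Unique-⊆⇒length≤ : Unique xs → xs ⊆ ys → length xs ≤ length ys
Unique-⊆⇒length≤ [] _ = z≤n
Unique-⊆⇒length≤ {xs = x ∷ xs} (x∉xs ∷ u) xs⊆ys
  with as , bs , refl ← ∈-∃++ (xs⊆ys (here refl)) = begin
  suc (length xs)              ≤⟨ s≤s (Unique-⊆⇒length≤ u xs⊆as++bs) ⟩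
  suc (length (as ++ bs))      ≡⟨ cong suc (length-++ as) ⟩
  suc (length as + length bs)  ≡⟨ +-suc (length as) (length bs) ⟨
  length as + suc (length bs)  ≡⟨ length-++ as ⟨
  length (as ++ x ∷ bs)        ∎
  where
  open ≤-Reasoning
  xs⊆as++bs : xs ⊆ as ++ bs
  xs⊆as++bs y∈xs = ∈-delete as (xs⊆ys (there y∈xs))
    λ y≡x → All¬⇒¬Any x∉xs (subst (_∈ˡ xs) y≡x y∈xs)

-- A repeated entry could be dropped, and `us` would then lie in a list shorter than itself. `ws`
-- holds the entries already passed, so that the length bound survives the recursion.
⊆-length≥⇒Unique : ∀ ws xs → Unique us → us ⊆ ws ++ xs →
                   length ws + length xs ≤ length us → Unique xs
⊆-length≥⇒Unique ws [] _ _ _ = []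
⊆-length≥⇒Unique {us = us} ws (x ∷ xs) u us⊆ len =
  ¬Any⇒All¬ xs x∉xs ∷ ⊆-length≥⇒Unique (x ∷ ws) xs u (shift ∘ us⊆) len′
  where
  len′ : suc (length ws + length xs) ≤ length us
  len′ = subst (_≤ length us) (+-suc (length ws) (length xs)) len

  shift : ws ++ x ∷ xs ⊆ x ∷ ws ++ xs
  shift y∈ with ∈-++⁻ ws y∈
  ... | inj₁ y∈ws = there (∈-++⁺ˡ y∈ws)
  ... | inj₂ (here y≡x) = here y≡x
  ... | inj₂ (there y∈xs) = there (∈-++⁺ʳ ws y∈xs)

  x∉xs : x ∉ˡ xs
  x∉xs x∈xs = <⇒≱ len′ (subst (length us ≤_) (length-++ ws)
    (Unique-⊆⇒length≤ u (drop-x ∘ us⊆)))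
    where
    drop-x : ws ++ x ∷ xs ⊆ ws ++ xs
    drop-x y∈ with ∈-++⁻ ws y∈
    ... | inj₁ y∈ws = ∈-++⁺ˡ y∈ws
    ... | inj₂ (here refl) = ∈-++⁺ʳ ws x∈xs
    ... | inj₂ (there y∈xs) = ∈-++⁺ʳ ws y∈xs

-- An entry of `ys` missing from `xs` could be put in front of `xs`, giving a list without
-- repetition that lies in `ys` but is longer.
Unique-length≥⇒⊇ : ∀ {xs ys : List A} → DecidableEquality A → Unique xs → xs ⊆ ys →
                   length ys ≤ length xs → ys ⊆ xs
Unique-length≥⇒⊇ {xs = xs} {ys = ys} _≟_ u xs⊆ys len {y} y∈ys with any? (y ≟_) xs
... | yes y∈xs = y∈xs
... | no y∉xs = contradiction
  (Unique-⊆⇒length≤ (¬Any⇒All¬ xs y∉xs ∷ u) y∷xs⊆ys) (≤⇒≯ len)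
  where
  y∷xs⊆ys : y ∷ xs ⊆ ys
  y∷xs⊆ys (here refl) = y∈ys
  y∷xs⊆ys (there z∈xs) = xs⊆ys z∈xs

-- Enumeration of the dihedral group.

module _ {m : ℕ} where

  rot-injective : ∀ {i j : Fin m} → rot i ≡ rot j → i ≡ j
  rot-injective refl = refl

  ref-injective : ∀ {i j : Fin m} → ref i ≡ ref j → i ≡ j
  ref-injective refl = refl

  infix 4 _≟ᴰ_

  _≟ᴰ_ : DecidableEquality (Dihedral m)
  rot i ≟ᴰ rot j = map′ (cong rot) rot-injective (i Fin.≟ j)
  rot i ≟ᴰ ref j = no λ ()
  ref i ≟ᴰ rot j = no λ ()
  ref i ≟ᴰ ref j = map′ (cong ref) ref-injective (i Fin.≟ j)

  elements : List (Dihedral m)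
  elements = map rot (allFin m) ++ map ref (allFin m)

  ∈-elements : ∀ g → g ∈ˡ elements
  ∈-elements (rot i) = ∈-++⁺ˡ (∈-map⁺ rot (∈-allFin i))
  ∈-elements (ref i) = ∈-++⁺ʳ (map rot (allFin m)) (∈-map⁺ ref (∈-allFin i))

  elements-unique : Unique elements
  elements-unique =
    ++⁺ (map⁺ rot-injective (allFin⁺ m)) (map⁺ ref-injective (allFin⁺ m)) disjoint
    where
    disjoint : ∀ {g} → ¬ (g ∈ˡ map rot (allFin m) × g ∈ˡ map ref (allFin m))
    disjoint (g∈rots , g∈refs) with ∈-map⁻ rot g∈rots | ∈-map⁻ ref g∈refs
    ... | _ , _ , refl | _ , _ , ()

  length-elements : length elements ≡ m + m
  length-elements = begin
    length elements
      ≡⟨ length-++ (map rot (allFin m)) ⟩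
    length (map rot (allFin m)) + length (map ref (allFin m))
      ≡⟨ cong₂ _+_ (length-map rot (allFin m)) (length-map ref (allFin m)) ⟩
    length (allFin m) + length (allFin m)
      ≡⟨ cong₂ _+_ (length-tabulate {n = m} id) (length-tabulate {n = m} id) ⟩
    m + m  ∎
    where open ≡-Reasoning

  -- Among `m + m` entries that meet `m + m` elements there is no room for a repetition. This
  -- replaces pairwise comparison, both for the path and for its steps.
  covering⇒Unique : ∀ gs → (∀ g → g ∈ˡ gs) → length gs ≡ m + m → Unique gs
  covering⇒Unique gs all∈ len = ⊆-length≥⇒Unique [] gs elements-unique
    (λ {g} _ → all∈ g) (≤-reflexive (trans len (sym length-elements)))

  Unique⇒covering : ∀ {gs} → Unique gs → length gs ≡ m + m → ∀ g → g ∈ˡ gs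
  Unique⇒covering u len g = Unique-length≥⇒⊇ _≟ᴰ_ u (λ {h} _ → ∈-elements h)
    (≤-reflexive (trans length-elements (sym len))) (∈-elements g)

-- Zigzags and their consecutive pairs.

data Consecutive (x y : A) : List A → Set where
  now   : ∀ {zs} → Consecutive x y (x ∷ y ∷ zs)
  later : ∀ {z zs} → Consecutive x y zs → Consecutive x y (z ∷ zs)

-- zigzag f g k is f 0 , g 0 , f 1 , g 1 , … , g (k - 1) , f k , followed by the tail.
mutual
  zigzag : (f g : ℕ → A) → ℕ → List A → List A
  zigzag f g k xs = f 0 ∷ zigzag′ f g k xs

  zigzag′ : (f g : ℕ → A) → ℕ → List A → List A
  zigzag′ f g zero    xs = xs
  zigzag′ f g (suc k) xs = g 0 ∷ zigzag (f ∘ suc) (g ∘ suc) k xs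

length-zigzag : ∀ (f g : ℕ → A) k xs → length (zigzag f g k xs) ≡ suc (k + k + length xs)
length-zigzag f g zero xs = refl
length-zigzag f g (suc k) xs = cong suc (trans
  (cong suc (length-zigzag (f ∘ suc) (g ∘ suc) k xs))
  (cong (λ n → suc (n + length xs)) (sym (+-suc k k))))

∈-zigzagᶠ : ∀ (f g : ℕ → A) {i k xs} → i ≤ k → f i ∈ˡ zigzag f g k xs
∈-zigzagᶠ f g z≤n = here refl
∈-zigzagᶠ f g (s≤s i≤k) = there (there (∈-zigzagᶠ (f ∘ suc) (g ∘ suc) i≤k))

∈-zigzagᵍ : ∀ (f g : ℕ → A) {i k xs} → i < k → g i ∈ˡ zigzag f g k xs
∈-zigzagᵍ f g z<s = there (here refl)
∈-zigzagᵍ f g (s<s i<k@(s≤s _)) = there (there (∈-zigzagᵍ (f ∘ suc) (g ∘ suc) i<k))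

∈-zigzagᵗ : ∀ (f g : ℕ → A) k {x xs} → x ∈ˡ xs → x ∈ˡ zigzag f g k xs
∈-zigzagᵗ f g zero x∈xs = there x∈xs
∈-zigzagᵗ f g (suc k) x∈xs = there (there (∈-zigzagᵗ (f ∘ suc) (g ∘ suc) k x∈xs))

zigzag-fg : ∀ (f g : ℕ → A) {i k xs} → i < k →
            Consecutive (f i) (g i) (zigzag f g k xs)
zigzag-fg f g z<s = now
zigzag-fg f g (s<s i<k@(s≤s _)) = later (later (zigzag-fg (f ∘ suc) (g ∘ suc) i<k))

zigzag-gf : ∀ (f g : ℕ → A) {i k xs} → i < k →
            Consecutive (g i) (f (suc i)) (zigzag f g k xs)
zigzag-gf f g z<s = later now
zigzag-gf f g (s<s i<k@(s≤s _)) = later (later (zigzag-gf (f ∘ suc) (g ∘ suc) i<k))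

zigzag-last : ∀ (f g : ℕ → A) k {x xs} → Consecutive (f k) x (zigzag f g k (x ∷ xs))
zigzag-last f g zero = now
zigzag-last f g (suc k) = later (later (zigzag-last (f ∘ suc) (g ∘ suc) k))

zigzag-tail : ∀ (f g : ℕ → A) k {x y xs} → Consecutive x y xs →
              Consecutive x y (zigzag f g k xs)
zigzag-tail f g zero c = later c
zigzag-tail f g (suc k) c = later (later (zigzag-tail (f ∘ suc) (g ∘ suc) k c))

-- Integer exponents scaled by a multiplier, and the steps of a path.

module DihedralCoordinates (m : ℕ) .{{_ : NonZero m}} (a : ℕ) where

  open ModularArithmetic m
  open DihedralGroup m using (⊖-⊕; _·_; e; inv; ·-assoc; ·-identityˡ; ·-inverseʳ)
  open AbelianGroup ⊕-abelianGroup using (identityʳ; inverseʳ)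
  open AbelianGroupProperties ⊕-abelianGroup using (⁻¹-∙-comm; ⁻¹-involutive; ε⁻¹≈ε)
  open ≡-Reasoning

  -- The residue of an integer multiple of `a`. When `a` is a unit, this applies the automorphism
  -- taking `u` to its power `a` and fixing `v`, so that one integer pattern serves every such
  -- multiplier.
  ⟦_⟧ : ℤ → Fin m
  ⟦ + n ⟧      = (n * a) mod m
  ⟦ -[1+ n ] ⟧ = ⊝ ((suc n * a) mod m)

  +-⟦⟧ : ∀ k n → ⟦ + (k + n) ⟧ ≡ ⟦ + k ⟧ ⊕ ⟦ + n ⟧
  +-⟦⟧ k n = begin
    ((k + n) * a) mod m            ≡⟨ cong (_mod m) (*-distribʳ-+ a k n) ⟩
    (k * a + n * a) mod m          ≡⟨ mod-⊕ (k * a) (n * a) ⟨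
    (k * a) mod m ⊕ (n * a) mod m  ∎

  neg-⟦⟧ : ∀ z → ⟦ - z ⟧ ≡ ⊝ ⟦ z ⟧
  neg-⟦⟧ (+ zero) = sym ε⁻¹≈ε
  neg-⟦⟧ (+ suc n) = refl
  neg-⟦⟧ -[1+ n ] = sym (⁻¹-involutive _)

  ⊖-⟦⟧ : ∀ k n → ⟦ k ⊖ℤ n ⟧ ≡ ⟦ + k ⟧ ⊖ ⟦ + n ⟧
  ⊖-⟦⟧ k zero = sym (trans (cong (⟦ + k ⟧ ⊕_) ε⁻¹≈ε) (identityʳ _))
  ⊖-⟦⟧ zero (suc n) = sym (⊕-identityˡ _)
  ⊖-⟦⟧ (suc k) (suc n) = begin
    ⟦ suc k ⊖ℤ suc n ⟧                ≡⟨ cong ⟦_⟧ (ℤ.[1+m]⊖[1+n]≡m⊖n k n) ⟩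
    ⟦ k ⊖ℤ n ⟧                        ≡⟨ ⊖-⟦⟧ k n ⟩
    ⟦ + k ⟧ ⊖ ⟦ + n ⟧                 ≡⟨ cong (_⊖ ⟦ + n ⟧) cancel ⟨
    (⟦ + suc k ⟧ ⊖ ⟦ 1ℤ ⟧) ⊖ ⟦ + n ⟧  ≡⟨ ⊖-⊕ ⟦ + suc k ⟧ ⟦ 1ℤ ⟧ ⟦ + n ⟧ ⟩
    ⟦ + suc k ⟧ ⊖ (⟦ 1ℤ ⟧ ⊕ ⟦ + n ⟧)  ≡⟨ cong (⟦ + suc k ⟧ ⊖_) (+-⟦⟧ 1 n) ⟨
    ⟦ + suc k ⟧ ⊖ ⟦ + suc n ⟧         ∎
    where
    cancel : ⟦ + suc k ⟧ ⊖ ⟦ 1ℤ ⟧ ≡ ⟦ + k ⟧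
    cancel = begin
      ⟦ + suc k ⟧ ⊖ ⟦ 1ℤ ⟧         ≡⟨ cong (λ n → ⟦ + n ⟧ ⊖ ⟦ 1ℤ ⟧) (+-comm 1 k) ⟩
      ⟦ + (k + 1) ⟧ ⊖ ⟦ 1ℤ ⟧       ≡⟨ cong (_⊖ ⟦ 1ℤ ⟧) (+-⟦⟧ k 1) ⟩
      (⟦ + k ⟧ ⊕ ⟦ 1ℤ ⟧) ⊖ ⟦ 1ℤ ⟧  ≡⟨ ⊕-assoc _ _ _ ⟩
      ⟦ + k ⟧ ⊕ (⟦ 1ℤ ⟧ ⊖ ⟦ 1ℤ ⟧)  ≡⟨ cong (⟦ + k ⟧ ⊕_) (inverseʳ ⟦ 1ℤ ⟧) ⟩
      ⟦ + k ⟧ ⊕ 𝟘                  ≡⟨ identityʳ _ ⟩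
      ⟦ + k ⟧                      ∎

  ⟦⟧-+ : ∀ y z → ⟦ y +ℤ z ⟧ ≡ ⟦ y ⟧ ⊕ ⟦ z ⟧
  ⟦⟧-+ (+ k) (+ n) = +-⟦⟧ k n
  ⟦⟧-+ (+ k) -[1+ n ] = ⊖-⟦⟧ k (suc n)
  ⟦⟧-+ -[1+ k ] (+ n) = trans (⊖-⟦⟧ n (suc k)) (⊕-comm ⟦ + n ⟧ ⟦ -[1+ k ] ⟧)
  ⟦⟧-+ -[1+ k ] -[1+ n ] = begin
    ⊝ ⟦ + suc (suc (k + n)) ⟧      ≡⟨ cong (λ n → ⊝ ⟦ + suc n ⟧) (+-suc k n) ⟨
    ⊝ ⟦ + (suc k + suc n) ⟧        ≡⟨ cong ⊝_ (+-⟦⟧ (suc k) (suc n)) ⟩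
    ⊝ (⟦ + suc k ⟧ ⊕ ⟦ + suc n ⟧)  ≡⟨ ⁻¹-∙-comm ⟦ + suc k ⟧ ⟦ + suc n ⟧ ⟨
    ⟦ -[1+ k ] ⟧ ⊕ ⟦ -[1+ n ] ⟧    ∎

  ⟦⟧-− : ∀ y z → ⟦ y -ℤ z ⟧ ≡ ⟦ y ⟧ ⊖ ⟦ z ⟧
  ⟦⟧-− y z = trans (⟦⟧-+ y (- z)) (cong (⟦ y ⟧ ⊕_) (neg-⟦⟧ z))

  ⟦m⟧ : ⟦ + m ⟧ ≡ 𝟘
  ⟦m⟧ = mod-cong (trans (cong (_% m) (*-comm m a))
                        (trans (m*n%n≡0 a m) (sym (m*n%n≡0 0 m))))

  ⟦⟧-periodic : ∀ z → ⟦ z +ℤ + m ⟧ ≡ ⟦ z ⟧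
  ⟦⟧-periodic z = trans (⟦⟧-+ z (+ m)) (trans (cong (⟦ z ⟧ ⊕_) ⟦m⟧) (identityʳ _))

  R F : ℤ → Dihedral m
  R z = rot ⟦ z ⟧
  F z = ref ⟦ z ⟧

  quotients : List (Dihedral m) → List (Dihedral m)
  quotients (g ∷ h ∷ gs) = inv g · h ∷ quotients (h ∷ gs)
  quotients _ = []

  length-quotients : ∀ g gs → length (quotients (g ∷ gs)) ≡ length gs
  length-quotients g [] = refl
  length-quotients g (h ∷ gs) = cong suc (length-quotients h gs)

  -- The products telescope, as `g` times `inv g · h` is `h`. So the partial products of the steps
  -- of a path from `e` retrace that path.
  scanl-quotients : ∀ g gs → scanl _·_ g (quotients (g ∷ gs)) ≡ g ∷ gs
  scanl-quotients g [] = refl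
  scanl-quotients g (h ∷ gs) = cong (g ∷_) (trans
    (cong (λ x → scanl _·_ x (quotients (h ∷ gs))) cancel) (scanl-quotients h gs))
    where
    cancel : g · (inv g · h) ≡ h
    cancel = begin
      g · (inv g · h)  ≡⟨ ·-assoc g (inv g) h ⟨
      (g · inv g) · h  ≡⟨ cong (_· h) (·-inverseʳ g) ⟩
      e · h            ≡⟨ ·-identityˡ h ⟩
      h                ∎

  Consecutive⇒∈ : ∀ {g h gs} → Consecutive g h gs → inv g · h ∈ˡ quotients gs
  Consecutive⇒∈ now = here refl
  -- A nonempty rest exposes the two leading vertices on which `quotients` computes.
  Consecutive⇒∈ (later {zs = _ ∷ _} c) = there (Consecutive⇒∈ c)

  inv-R-· : ∀ y z → ⊝ ⟦ y ⟧ ⊕ ⟦ z ⟧ ≡ ⟦ z -ℤ y ⟧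
  inv-R-· y z = trans (⊕-comm (⊝ ⟦ y ⟧) ⟦ z ⟧) (sym (⟦⟧-− z y))

  RR : ∀ {gs} y z → Consecutive (R y) (R z) gs → R (z -ℤ y) ∈ˡ quotients gs
  RR {gs} y z c = subst (_∈ˡ quotients gs) (cong rot (inv-R-· y z)) (Consecutive⇒∈ c)

  RF : ∀ {gs} y z → Consecutive (R y) (F z) gs → F (z -ℤ y) ∈ˡ quotients gs
  RF {gs} y z c = subst (_∈ˡ quotients gs) (cong ref (inv-R-· y z)) (Consecutive⇒∈ c)

  FR : ∀ {gs} y z → Consecutive (F y) (R z) gs → F (y -ℤ z) ∈ˡ quotients gs
  FR {gs} y z c = subst (_∈ˡ quotients gs) (cong ref (sym (⟦⟧-− y z))) (Consecutive⇒∈ c)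

  FF : ∀ {gs} y z → Consecutive (F y) (F z) gs → R (y -ℤ z) ∈ˡ quotients gs
  FF {gs} y z c = subst (_∈ˡ quotients gs) (cong rot (sym (⟦⟧-− y z))) (Consecutive⇒∈ c)

  module Surjectivity {b : ℕ} (ba≡1 : (b * a) % m ≡ 1 % m) where

    -- The coefficient is `i * b` reduced modulo `m`, since `b` inverts `a`.
    ⟦⟧-surjective : ∀ i → ∃[ k ] (k < m × ⟦ + k ⟧ ≡ i)
    ⟦⟧-surjective i = (toℕ i * b) % m , m%n<n (toℕ i * b) m ,
      trans (mod-cong (begin
        ((toℕ i * b) % m * a) % m            ≡⟨ %-distribˡ-* ((toℕ i * b) % m) a m ⟩
        ((toℕ i * b) % m % m * (a % m)) % m  ≡⟨ cong (λ k → (k * (a % m)) % m) (m%n%n≡m%n (toℕ i * b) m) ⟩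
        ((toℕ i * b) % m * (a % m)) % m      ≡⟨ %-distribˡ-* (toℕ i * b) a m ⟨
        (toℕ i * b * a) % m                  ≡⟨ cong (_% m) (*-assoc (toℕ i) b a) ⟩
        (toℕ i * (b * a)) % m                ≡⟨ %-distribˡ-* (toℕ i) (b * a) m ⟩
        (toℕ i % m * ((b * a) % m)) % m      ≡⟨ cong (λ k → (toℕ i % m * k) % m) ba≡1 ⟩
        (toℕ i % m * (1 % m)) % m            ≡⟨ %-distribˡ-* (toℕ i) 1 m ⟨
        (toℕ i * 1) % m                      ≡⟨ cong (_% m) (*-identityʳ (toℕ i)) ⟩
        toℕ i % m                            ∎)) (mod-toℕ i)

    -- Allows residues to be counted from any start; the reflections among the steps are counted
    -- from `p′`.
    ⟦⟧-surjective-from : ∀ z i → ∃[ k ] (k < m × ⟦ z +ℤ + k ⟧ ≡ i)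
    ⟦⟧-surjective-from z i with k , k<m , eq ← ⟦⟧-surjective (i ⊖ ⟦ z ⟧) = k , k<m , (begin
      ⟦ z +ℤ + k ⟧           ≡⟨ ⟦⟧-+ z (+ k) ⟩
      ⟦ z ⟧ ⊕ ⟦ + k ⟧        ≡⟨ cong (⟦ z ⟧ ⊕_) eq ⟩
      ⟦ z ⟧ ⊕ (i ⊖ ⟦ z ⟧)    ≡⟨ ⊕-comm ⟦ z ⟧ (i ⊖ ⟦ z ⟧) ⟩
      (i ⊖ ⟦ z ⟧) ⊕ ⟦ z ⟧    ≡⟨ ⊕-assoc i (⊝ ⟦ z ⟧) ⟦ z ⟧ ⟩
      i ⊕ (⊝ ⟦ z ⟧ ⊕ ⟦ z ⟧)  ≡⟨ cong (i ⊕_) (⊕-inverseˡ ⟦ z ⟧) ⟩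
      i ⊕ 𝟘                  ≡⟨ identityʳ i ⟩
      i                      ∎)

-- Covering a range of exponents by runs.

private variable
  P : ℕ → Set

infixr 5 _◂_

record Below (P : ℕ → Set) (n : ℕ) : Set where
  constructor below
  field at : ∀ {k} → k < n → P k

open Below

Below-0 : Below P 0
Below-0 = below λ ()

_◂_ : ∀ {n} → P 0 → Below (P ∘ suc) n → Below P (suc n)
(p ◂ ps) .at {zero} _ = p
(p ◂ ps) .at {suc k} (s≤s k<n) = ps .at k<n

Below-+ : ∀ j {n} → Below P j → Below (λ k → P (j + k)) n → Below P (j + n)
Below-+ zero ps qs = qs
Below-+ (suc j) ps qs = ps .at z<s ◂ Below-+ j (below (ps .at ∘ s<s)) qs

-- For runs whose even and odd offsets come from different kinds of steps, such as the two
-- directions of a zigzag.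
Below-pairs : ∀ n → Below (λ i → P (i + i) × P (suc (i + i))) n → Below P (n + n)
Below-pairs zero ps = Below-0
Below-pairs {P} (suc n) ps = proj₁ (ps .at z<s) ◂
  subst (Below (P ∘ suc)) (sym (+-suc n n)) (proj₂ (ps .at z<s) ◂ Below-pairs n (below λ {i} i<n →
    subst (λ k → P (suc k) × P (suc (suc k))) (+-suc i i) (ps .at (s<s i<n))))

-- `j` is the index counted from the other end, for values that fall as the index of a zigzag grows.
-- The equation is over the integers so that it can be inserted into ring identities.
reflect : ∀ {i n} → i < n → ∃[ j ] (j < n × + i ≡ + n -ℤ (1ℤ +ℤ + j))
reflect {i} {suc n} (s≤s i≤n) = n ∸ i , s≤s (m∸n≤m n i) , (begin
  + i                   ≡⟨ cong +_ (m∸[m∸n]≡n i≤n) ⟨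
  + (n ∸ (n ∸ i))       ≡⟨ ℤ.⊖-≥ (m∸n≤m n i) ⟨
  n ⊖ℤ (n ∸ i)          ≡⟨ ℤ.[1+m]⊖[1+n]≡m⊖n n (n ∸ i) ⟨
  suc n ⊖ℤ suc (n ∸ i)  ∎)
  where open ≡-Reasoning

-- The path, its vertices and its steps.

-- Here ℓ is suc p, and the letters a, b, c, d denote the four zigzags of the path.
module Construction (p k : ℕ) where

  m : ℕ
  m = 3 + 4 * suc p

  open DihedralCoordinates m k

  -- `m′` is `m` unfolded into sums, the shape in which the ring identities below add the modulus;
  -- they are proved for an integer variable and applied at `p′`.
  p′ m′ : ℤ
  p′ = + p
  m′ = + 7 +ℤ (p′ +ℤ p′ +ℤ p′ +ℤ p′)

  +m≡m′ : + m ≡ m′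
  +m≡m′ = cong +_ (identity p)
    where
    identity : ∀ p → 3 + 4 * suc p ≡ 7 + (p + p + p + p)
    identity = solve-∀

  at-R : ∀ {gs} y {z} → y ≡ z → R y ∈ˡ gs → R z ∈ˡ gs
  at-R y refl = id

  at-F : ∀ {gs} y {z} → y ≡ z → F y ∈ˡ gs → F z ∈ˡ gs
  at-F y refl = id

  wrap : ∀ y {z} → y +ℤ m′ ≡ z → ⟦ y ⟧ ≡ ⟦ z ⟧
  wrap y refl = trans (sym (⟦⟧-periodic y)) (cong (λ w → ⟦ y +ℤ w ⟧) +m≡m′)

  wrap-R : ∀ {gs} y {z} → y +ℤ m′ ≡ z → R y ∈ˡ gs → R z ∈ˡ gs
  wrap-R {gs} y eq = subst (λ i → rot i ∈ˡ gs) (wrap y eq)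

  wrap-F : ∀ {gs} y {z} → y +ℤ m′ ≡ z → F y ∈ˡ gs → F z ∈ˡ gs
  wrap-F {gs} y eq = subst (λ i → ref i ∈ˡ gs) (wrap y eq)

  a↑ a↓ b↑ b↓ c↓ c↑ d↑ d↓ : ℕ → Dihedral m
  a↑ i = R (+ 3 +ℤ + i)
  a↓ i = R (- (+ 1 +ℤ + i))
  b↑ i = F (+ 1 +ℤ + i)
  b↓ i = R (- (+ 1 +ℤ p′ +ℤ + i))
  c↓ i = R (+ 5 +ℤ p′ +ℤ p′ -ℤ + i)
  c↑ i = F (+ 3 +ℤ p′ +ℤ + i)
  d↑ i = F (+ 4 +ℤ p′ +ℤ p′ +ℤ + i)
  d↓ i = F (- (+ 2 +ℤ + i))

  -- The nesting lets `in-b`, `along-b` and their kin skip whole zigzags.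
  tail-d tail-c tail-b path : List (Dihedral m)
  tail-d = zigzag d↑ d↓ p (F (+ 5 +ℤ p′ +ℤ p′ +ℤ p′) ∷ [])
  tail-c = R (+ 1) ∷ zigzag c↓ c↑ (suc p) tail-d
  tail-b = F (+ 0) ∷ F (- + 1) ∷ zigzag b↑ b↓ (suc p) tail-c
  path   = R (+ 0) ∷ zigzag a↑ a↓ p tail-b

  x₀ : Dihedral m
  x₀ = R (+ 2 +ℤ p′ +ℤ p′)

  in-b : ∀ {g} → g ∈ˡ tail-b → g ∈ˡ path
  in-b g∈ = there (∈-zigzagᵗ a↑ a↓ p g∈)

  in-c : ∀ {g} → g ∈ˡ tail-c → g ∈ˡ path
  in-c g∈ = in-b (there (there (∈-zigzagᵗ b↑ b↓ (suc p) g∈)))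

  in-d : ∀ {g} → g ∈ˡ tail-d → g ∈ˡ path
  in-d g∈ = in-c (there (∈-zigzagᵗ c↓ c↑ (suc p) g∈))

  along-b : ∀ {g h} → Consecutive g h tail-b → Consecutive g h path
  along-b c = later (zigzag-tail a↑ a↓ p c)

  along-c : ∀ {g h} → Consecutive g h tail-c → Consecutive g h path
  along-c c = along-b (later (later (zigzag-tail b↑ b↓ (suc p) c)))

  along-d : ∀ {g h} → Consecutive g h tail-d → Consecutive g h path
  along-d c = along-c (later (zigzag-tail c↓ c↑ (suc p) c))

  length-path : length path ≡ 5 + 8 * suc p
  length-path = trans (cong suc (trans (length-zigzag a↑ a↓ p tail-b)
    (cong (λ n → suc (p + p + suc (suc n))) (trans (length-zigzag b↑ b↓ (suc p) tail-c)
    (cong (λ n → suc (suc p + suc p + suc n)) (trans (length-zigzag c↓ c↑ (suc p) tail-d)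
    (cong (λ n → suc (suc p + suc p + n)) (length-zigzag d↑ d↓ p _))))))))
    (size p)
    where
    size : ∀ p → suc (suc (p + p + suc (suc (suc (suc p + suc p + suc (suc (suc p + suc p +
         suc (p + p + 1)))))))) ≡ 5 + 8 * suc p
    size = solve-∀

  -- By exponent: 0 starts the path, 1 stands before zigzag c, and 2 is the missed vertex put in
  -- front. Then `a↑` runs up to ℓ + 2, `c↓` to 2ℓ + 3, `b↓` to 3ℓ + 3 and `a↓` to m - 1, the last
  -- two after adding m. The three descending runs are read backwards by `reflect`.
  path-rot : Below (λ k → R (+ k) ∈ˡ R (+ 2) ∷ path) m
  path-rot = subst (Below _) (size p) $
    there (here refl) ◂
    there (in-c (here refl)) ◂
    here refl ◂
    Below-+ (suc p) (below λ { (s≤s i≤p) → there (there (∈-zigzagᶠ a↑ a↓ i≤p)) })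
    (Below-+ (2 + p) (below λ {i} i<p+2 → case-c (reflect i<p+2))
    (Below-+ (suc p) (below λ {i} i<p+1 → case-b (reflect i<p+1))
    (below λ {i} i<p → case-a (reflect i<p))))
    where
    size : ∀ p → 3 + (suc p + (2 + p + (suc p + p))) ≡ 3 + 4 * suc p
    size = solve-∀

    case-c : ∀ {i} → ∃[ j ] (j < 2 + p × + i ≡ + (2 + p) -ℤ (+ 1 +ℤ + j)) →
             R (+ (3 + (suc p + i))) ∈ˡ R (+ 2) ∷ path
    case-c (j , s≤s j≤p+1 , eq) = at-R (+ 5 +ℤ p′ +ℤ p′ -ℤ + j)
      (trans (identity p′ (+ j)) (cong (λ z → + 3 +ℤ (+ 1 +ℤ p′ +ℤ z)) (sym eq)))
      (there (in-c (there (∈-zigzagᶠ c↓ c↑ j≤p+1))))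
      where
      identity : ∀ p j → + 5 +ℤ p +ℤ p -ℤ j ≡
                         + 3 +ℤ (+ 1 +ℤ p +ℤ (+ 2 +ℤ p -ℤ (+ 1 +ℤ j)))
      identity = solveℤ

    case-b : ∀ {i} → ∃[ j ] (j < suc p × + i ≡ + suc p -ℤ (+ 1 +ℤ + j)) →
             R (+ (3 + (suc p + (2 + p + i)))) ∈ˡ R (+ 2) ∷ path
    case-b (j , j<p+1 , eq) = wrap-R (- (+ 1 +ℤ p′ +ℤ + j))
      (trans (identity p′ (+ j))
        (cong (λ z → + 3 +ℤ (+ 1 +ℤ p′ +ℤ (+ 2 +ℤ p′ +ℤ z))) (sym eq)))
      (there (in-b (there (there (∈-zigzagᵍ b↑ b↓ j<p+1)))))
      where
      identity : ∀ p j → - (+ 1 +ℤ p +ℤ j) +ℤ (+ 7 +ℤ (p +ℤ p +ℤ p +ℤ p)) ≡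
                         + 3 +ℤ (+ 1 +ℤ p +ℤ (+ 2 +ℤ p +ℤ (+ 1 +ℤ p -ℤ (+ 1 +ℤ j))))
      identity = solveℤ

    case-a : ∀ {i} → ∃[ j ] (j < p × + i ≡ + p -ℤ (+ 1 +ℤ + j)) →
             R (+ (3 + (suc p + (2 + p + (suc p + i))))) ∈ˡ R (+ 2) ∷ path
    case-a (j , j<p , eq) = wrap-R (- (+ 1 +ℤ + j))
      (trans (identity p′ (+ j))
        (cong (λ z → + 3 +ℤ (+ 1 +ℤ p′ +ℤ (+ 2 +ℤ p′ +ℤ (+ 1 +ℤ p′ +ℤ z)))) (sym eq)))
      (there (there (∈-zigzagᵍ a↑ a↓ j<p)))
      where
      identity : ∀ p j → - (+ 1 +ℤ j) +ℤ (+ 7 +ℤ (p +ℤ p +ℤ p +ℤ p)) ≡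
                         + 3 +ℤ (+ 1 +ℤ p +ℤ (+ 2 +ℤ p +ℤ (+ 1 +ℤ p +ℤ (p -ℤ (+ 1 +ℤ j)))))
      identity = solveℤ

  -- By exponent: after 0, `b↑` runs up to ℓ + 1, `c↑` to 2ℓ + 1 and `d↑` to 3ℓ + 1; the end of the
  -- path is 3ℓ + 2, `d↓` read backwards reaches 4ℓ + 1, and `F -1` is 4ℓ + 2.
  path-ref : Below (λ k → F (+ k) ∈ˡ path) m
  path-ref = subst (Below _) (size p) $
    in-b (here refl) ◂
    Below-+ (2 + p) (below λ { (s≤s i≤p+1) →
      in-b (there (there (∈-zigzagᶠ b↑ b↓ i≤p+1))) })
    (Below-+ (suc p) (below λ {i} i<p+1 → at-F (+ 3 +ℤ p′ +ℤ + i) (identity₁ p′ (+ i))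
      (in-c (there (∈-zigzagᵍ c↓ c↑ i<p+1))))
    (Below-+ (suc p) (below λ { {i} (s≤s i≤p) → at-F (+ 4 +ℤ p′ +ℤ p′ +ℤ + i)
      (identity₂ p′ (+ i)) (in-d (∈-zigzagᶠ d↑ d↓ i≤p)) })
    (at-F (+ 5 +ℤ p′ +ℤ p′ +ℤ p′) (identity₃ p′) (in-d (∈-zigzagᵗ d↑ d↓ p (here refl))) ◂
    Below-+ p (below λ {i} i<p → case-d (reflect i<p))
    (wrap-F (- + 1) (identity₅ p′) (in-b (there (here refl))) ◂ Below-0))))
    where
    size : ∀ p → suc (2 + p + (suc p + (suc p + suc (p + 1)))) ≡ 3 + 4 * suc p
    size = solve-∀

    identity₁ : ∀ p i → + 3 +ℤ p +ℤ i ≡ + 1 +ℤ (+ 2 +ℤ p +ℤ i)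
    identity₁ = solveℤ

    identity₂ : ∀ p i → + 4 +ℤ p +ℤ p +ℤ i ≡ + 1 +ℤ (+ 2 +ℤ p +ℤ (+ 1 +ℤ p +ℤ i))
    identity₂ = solveℤ

    identity₃ : ∀ p → + 5 +ℤ p +ℤ p +ℤ p ≡
                      + 1 +ℤ (+ 2 +ℤ p +ℤ (+ 1 +ℤ p +ℤ (+ 1 +ℤ p +ℤ + 0)))
    identity₃ = solveℤ

    identity₅ : ∀ p → - + 1 +ℤ (+ 7 +ℤ (p +ℤ p +ℤ p +ℤ p)) ≡
      + 1 +ℤ (+ 2 +ℤ p +ℤ (+ 1 +ℤ p +ℤ (+ 1 +ℤ p +ℤ (+ 1 +ℤ (p +ℤ + 0)))))
    identity₅ = solveℤ

    case-d : ∀ {i} → ∃[ j ] (j < p × + i ≡ + p -ℤ (+ 1 +ℤ + j)) →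
             F (+ suc (2 + p + (suc p + (suc p + suc i)))) ∈ˡ path
    case-d (j , j<p , eq) = wrap-F (- (+ 2 +ℤ + j))
      (trans (identity₄ p′ (+ j))
        (cong (λ z → + 1 +ℤ (+ 2 +ℤ p′ +ℤ (+ 1 +ℤ p′ +ℤ (+ 1 +ℤ p′ +ℤ (+ 1 +ℤ z))))) (sym eq)))
      (in-d (∈-zigzagᵍ d↑ d↓ j<p))
      where
      identity₄ : ∀ p j → - (+ 2 +ℤ j) +ℤ (+ 7 +ℤ (p +ℤ p +ℤ p +ℤ p)) ≡
        + 1 +ℤ (+ 2 +ℤ p +ℤ (+ 1 +ℤ p +ℤ (+ 1 +ℤ p +ℤ (+ 1 +ℤ (p -ℤ (+ 1 +ℤ j))))))
      identity₄ = solveℤ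

  -- In the versions marked ↻ the difference needs to be reduced by adding m.
  step-RR : ∀ y z {w} → z -ℤ y ≡ w →
    Consecutive (R y) (R z) path → R w ∈ˡ quotients path
  step-RR y z eq c = at-R (z -ℤ y) eq (RR y z c)

  step-RR↻ : ∀ y z {w} → (z -ℤ y) +ℤ m′ ≡ w →
    Consecutive (R y) (R z) path → R w ∈ˡ quotients path
  step-RR↻ y z eq c = wrap-R (z -ℤ y) eq (RR y z c)

  step-RF : ∀ y z {w} → z -ℤ y ≡ w →
    Consecutive (R y) (F z) path → F w ∈ˡ quotients path
  step-RF y z eq c = at-F (z -ℤ y) eq (RF y z c)

  step-RF↻ : ∀ y z {w} → (z -ℤ y) +ℤ m′ ≡ w →
    Consecutive (R y) (F z) path → F w ∈ˡ quotients path
  step-RF↻ y z eq c = wrap-F (z -ℤ y) eq (RF y z c)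

  step-FR : ∀ y z {w} → y -ℤ z ≡ w →
    Consecutive (F y) (R z) path → F w ∈ˡ quotients path
  step-FR y z eq c = at-F (y -ℤ z) eq (FR y z c)

  step-FR↻ : ∀ y z {w} → (y -ℤ z) +ℤ m′ ≡ w →
    Consecutive (F y) (R z) path → F w ∈ˡ quotients path
  step-FR↻ y z eq c = wrap-F (y -ℤ z) eq (FR y z c)

  step-FF : ∀ y z {w} → y -ℤ z ≡ w →
    Consecutive (F y) (F z) path → R w ∈ˡ quotients path
  step-FF y z eq c = at-R (y -ℤ z) eq (FF y z c)

  step-FF↻ : ∀ y z {w} → (y -ℤ z) +ℤ m′ ≡ w →
    Consecutive (F y) (F z) path → R w ∈ˡ quotients path
  step-FF↻ y z eq c = wrap-R (y -ℤ z) eq (FF y z c)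

  -- Counted from ℓ - 1, the steps form whole runs: the exits from c and b, the steps
  -- inside b, the exit from a, the steps inside c.
  quotients-ref : Below (λ k → F (p′ +ℤ + k) ∈ˡ quotients path) m
  quotients-ref = subst (Below _) (size p) $
    step-RF (+ 5 +ℤ p′ +ℤ p′ -ℤ + suc p) (+ 4 +ℤ p′ +ℤ p′ +ℤ + 0)
      (identity₁ p′)
      (along-c (later (zigzag-last c↓ c↑ (suc p)))) ◂
    step-FR (+ 1 +ℤ + suc p) (+ 1)
      (identity₂ p′)
      (along-b (later (later (zigzag-last b↑ b↓ (suc p))))) ◂
    -- In b the two exponents move apart by one at each step, so the differences run from ℓ + 1 to
    -- 3ℓ without a gap.
    Below-+ (suc p + suc p) (Below-pairs (suc p) (below λ {i} i<p+1 →
      step-FR (+ 1 +ℤ + i) (- (+ 1 +ℤ p′ +ℤ + i))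
        (identity₃ p′ (+ i))
        (along-b (later (later (zigzag-fg b↑ b↓ i<p+1)))) ,
      step-RF (- (+ 1 +ℤ p′ +ℤ + i)) (+ 1 +ℤ + suc i)
        (identity₄ p′ (+ i))
        (along-b (later (later (zigzag-gf b↑ b↓ i<p+1))))))
    (step-RF↻ (+ 3 +ℤ p′) (+ 0)
       (identity₅ p′)
       (later (zigzag-last a↑ a↓ p)) ◂
    Below-pairs (suc p) (below λ {i} i<p+1 →
      step-RF↻ (+ 5 +ℤ p′ +ℤ p′ -ℤ + i) (+ 3 +ℤ p′ +ℤ + i)
        (identity₆ p′ (+ i))
        (along-c (later (zigzag-fg c↓ c↑ i<p+1))) ,
      step-FR↻ (+ 3 +ℤ p′ +ℤ + i) (+ 5 +ℤ p′ +ℤ p′ -ℤ + suc i)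
        (identity₇ p′ (+ i))
        (along-c (later (zigzag-gf c↓ c↑ i<p+1)))))
    where
    size : ∀ p → 2 + (suc p + suc p + suc (suc p + suc p)) ≡ 3 + 4 * suc p
    size = solve-∀

    identity₁ : ∀ p → (+ 4 +ℤ p +ℤ p +ℤ + 0) -ℤ (+ 5 +ℤ p +ℤ p -ℤ (+ 1 +ℤ p)) ≡ p +ℤ + 0
    identity₁ = solveℤ

    identity₂ : ∀ p → (+ 1 +ℤ (+ 1 +ℤ p)) -ℤ + 1 ≡ p +ℤ + 1
    identity₂ = solveℤ

    identity₃ : ∀ p i → (+ 1 +ℤ i) -ℤ - (+ 1 +ℤ p +ℤ i) ≡ p +ℤ (+ 2 +ℤ (i +ℤ i))
    identity₃ = solveℤ

    identity₄ : ∀ p i → (+ 1 +ℤ (+ 1 +ℤ i)) -ℤ - (+ 1 +ℤ p +ℤ i) ≡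
                        p +ℤ (+ 2 +ℤ (+ 1 +ℤ (i +ℤ i)))
    identity₄ = solveℤ

    identity₅ : ∀ p → (+ 0 -ℤ (+ 3 +ℤ p)) +ℤ (+ 7 +ℤ (p +ℤ p +ℤ p +ℤ p)) ≡
                      p +ℤ (+ 2 +ℤ (+ 1 +ℤ p +ℤ (+ 1 +ℤ p) +ℤ + 0))
    identity₅ = solveℤ

    identity₆ : ∀ p i →
      ((+ 3 +ℤ p +ℤ i) -ℤ (+ 5 +ℤ p +ℤ p -ℤ i)) +ℤ (+ 7 +ℤ (p +ℤ p +ℤ p +ℤ p)) ≡
      p +ℤ (+ 2 +ℤ (+ 1 +ℤ p +ℤ (+ 1 +ℤ p) +ℤ (+ 1 +ℤ (i +ℤ i))))
    identity₆ = solveℤ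

    identity₇ : ∀ p i →
      ((+ 3 +ℤ p +ℤ i) -ℤ (+ 5 +ℤ p +ℤ p -ℤ (+ 1 +ℤ i))) +ℤ (+ 7 +ℤ (p +ℤ p +ℤ p +ℤ p)) ≡
      p +ℤ (+ 2 +ℤ (+ 1 +ℤ p +ℤ (+ 1 +ℤ p) +ℤ (+ 1 +ℤ (+ 1 +ℤ (i +ℤ i)))))
    identity₇ = solveℤ

  -- Zigzag a yields the odd differences from 5 to 4ℓ - 1: it alternates between odd and negative
  -- even ones, and adding the odd m makes the latter odd. Likewise d yields the even ones from 2 to
  -- 4ℓ, except 2ℓ and 2ℓ + 2. Single steps supply 1, 3, 2ℓ + 2, 4ℓ + 1 and 4ℓ + 2, which leaves 0
  -- and 2ℓ.
  quotients-rot : Below (λ k → R (+ k) ∈ˡ R (+ 0) ∷ x₀ ∷ quotients path) m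
  quotients-rot = subst (Below _) (size p) $
    here refl ◂
    on-path (step-FF (+ 0) (- + 1) refl (along-b now)) ◂
    Below-+ (p + p) (Below-pairs p (below λ {i} i<p →
      even (reflect i<p) , odd (<⇒≤ i<p)))
    -- The even value 2ℓ is `x₀`; its successor 2ℓ + 1 is the last value of `odd`.
    (there (here (cong R (identity₁ p′))) ◂
    at-R _ (identity₂ p′) (odd ≤-refl) ◂
    on-path (step-RR (+ 1) (+ 5 +ℤ p′ +ℤ p′ -ℤ + 0)
      (identity₃ p′)
      (along-c now)) ◂
    Below-+ (p + p) (Below-pairs p (below λ {i} i<p →
      case-a (reflect i<p) ,
      on-path (step-FF (+ 4 +ℤ p′ +ℤ p′ +ℤ + i) (- (+ 2 +ℤ + i))
        (identity₄ p′ (+ i))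
        (along-d (zigzag-fg d↑ d↓ i<p)))))
    (on-path (step-FF↻ (- + 1) (+ 1)
       (identity₅ p′)
        (along-b (later now))) ◂
    on-path (step-FF↻ (+ 4 +ℤ p′ +ℤ p′ +ℤ p′) (+ 5 +ℤ p′ +ℤ p′ +ℤ p′)
      (identity₆ p′)
      (along-d (zigzag-last d↑ d↓ p))) ◂
    Below-0))
    where
    size : ∀ p → 2 + (p + p + (3 + (p + p + 2))) ≡ 3 + 4 * suc p
    size = solve-∀

    on-path : ∀ {g} → g ∈ˡ quotients path →
              g ∈ˡ R (+ 0) ∷ x₀ ∷ quotients path
    on-path g∈ = there (there g∈)

    odd : ∀ {i} → i ≤ p →
          R (+ (2 + suc (i + i))) ∈ˡ R (+ 0) ∷ x₀ ∷ quotients path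
    -- The value 3 comes from the entry into zigzag a, before its own steps.
    odd {zero} _ = on-path (step-RR (+ 0) (+ 3) refl now)
    odd {suc i} i<p = on-path (step-RR (- (+ 1 +ℤ + i)) (+ 3 +ℤ + suc i)
        (identity (+ i))
        (later (zigzag-gf a↑ a↓ i<p)))
      where
      identity : ∀ i → (+ 3 +ℤ (+ 1 +ℤ i)) -ℤ - (+ 1 +ℤ i) ≡
                       + 3 +ℤ (+ 1 +ℤ i +ℤ (+ 1 +ℤ i))
      identity = solveℤ

    even : ∀ {i} → ∃[ j ] (j < p × + i ≡ + p -ℤ (+ 1 +ℤ + j)) →
           R (+ (2 + (i + i))) ∈ˡ R (+ 0) ∷ x₀ ∷ quotients path
    even (j , j<p , eq) = on-path (step-FF↻ (- (+ 2 +ℤ + j)) (+ 4 +ℤ p′ +ℤ p′ +ℤ + suc j)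
        (trans (identity p′ (+ j)) (cong (λ z → + 2 +ℤ (z +ℤ z)) (sym eq)))
        (along-d (zigzag-gf d↑ d↓ j<p)))
      where
      identity : ∀ p j →
        (- (+ 2 +ℤ j) -ℤ (+ 4 +ℤ p +ℤ p +ℤ (+ 1 +ℤ j))) +ℤ (+ 7 +ℤ (p +ℤ p +ℤ p +ℤ p)) ≡
        + 2 +ℤ (p -ℤ (+ 1 +ℤ j) +ℤ (p -ℤ (+ 1 +ℤ j)))
      identity = solveℤ

    case-a : ∀ {i} → ∃[ j ] (j < p × + i ≡ + p -ℤ (+ 1 +ℤ + j)) →
             R (+ (2 + (p + p + (3 + (i + i))))) ∈ˡ R (+ 0) ∷ x₀ ∷ quotients path
    case-a (j , j<p , eq) = on-path (step-RR↻ (+ 3 +ℤ + j) (- (+ 1 +ℤ + j))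
        (trans (identity p′ (+ j))
          (cong (λ z → + 2 +ℤ (p′ +ℤ p′ +ℤ (+ 3 +ℤ (z +ℤ z)))) (sym eq)))
        (later (zigzag-fg a↑ a↓ j<p)))
      where
      identity : ∀ p j →
        (- (+ 1 +ℤ j) -ℤ (+ 3 +ℤ j)) +ℤ (+ 7 +ℤ (p +ℤ p +ℤ p +ℤ p)) ≡
        + 2 +ℤ (p +ℤ p +ℤ (+ 3 +ℤ (p -ℤ (+ 1 +ℤ j) +ℤ (p -ℤ (+ 1 +ℤ j)))))
      identity = solveℤ

    identity₁ : ∀ p → + 2 +ℤ (p +ℤ p +ℤ + 0) ≡ + 2 +ℤ p +ℤ p
    identity₁ = solveℤ

    identity₂ : ∀ p → + 3 +ℤ (p +ℤ p) ≡ + 2 +ℤ (p +ℤ p +ℤ + 1)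
    identity₂ = solveℤ

    identity₃ : ∀ p → (+ 5 +ℤ p +ℤ p -ℤ + 0) -ℤ + 1 ≡ + 2 +ℤ (p +ℤ p +ℤ + 2)
    identity₃ = solveℤ

    identity₄ : ∀ p i → ((+ 4 +ℤ p +ℤ p +ℤ i) -ℤ - (+ 2 +ℤ i)) ≡
                        + 2 +ℤ (p +ℤ p +ℤ (+ 3 +ℤ (+ 1 +ℤ (i +ℤ i))))
    identity₄ = solveℤ

    identity₅ : ∀ p → (- + 1 -ℤ + 1) +ℤ (+ 7 +ℤ (p +ℤ p +ℤ p +ℤ p)) ≡
                      + 2 +ℤ (p +ℤ p +ℤ (+ 3 +ℤ (p +ℤ p +ℤ + 0)))
    identity₅ = solveℤ

    identity₆ : ∀ p →
      ((+ 4 +ℤ p +ℤ p +ℤ p) -ℤ (+ 5 +ℤ p +ℤ p +ℤ p)) +ℤ (+ 7 +ℤ (p +ℤ p +ℤ p +ℤ p)) ≡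
      + 2 +ℤ (p +ℤ p +ℤ (+ 3 +ℤ (p +ℤ p +ℤ + 1)))
    identity₆ = solveℤ

  -- Distinctness of vertices and steps by counting.

  module _ {k⁻¹ : ℕ} (inverse : (k⁻¹ * k) % m ≡ 1 % m) where

    open Surjectivity {b = k⁻¹} inverse
    open DihedralGroup m using (e; group)
    open GroupDefs group using (partialProducts)

    quotients-cover : ∀ g → g ∈ˡ e ∷ x₀ ∷ quotients path
    quotients-cover (rot i) with j , j<m , refl ← ⟦⟧-surjective i =
      quotients-rot .at j<m
    quotients-cover (ref i) with j , j<m , refl ← ⟦⟧-surjective-from p′ i =
      there (there (quotients-ref .at j<m))

    path-cover : ∀ g → g ∈ˡ R (+ 2) ∷ path
    path-cover (rot i) with j , j<m , refl ← ⟦⟧-surjective i = path-rot .at j<m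
    path-cover (ref i) with j , j<m , refl ← ⟦⟧-surjective i = there (path-ref .at j<m)

    quotients-unique : Unique (e ∷ x₀ ∷ quotients path)
    quotients-unique = covering⇒Unique _ quotients-cover
      (trans (cong (suc ∘ suc) (trans (length-quotients (R (+ 0)) (zigzag a↑ a↓ p tail-b))
        (suc-injective length-path))) (size p))
      where
      size : ∀ p → 2 + (4 + 8 * suc p) ≡ 3 + 4 * suc p + (3 + 4 * suc p)
      size = solve-∀

    -- As `R 0` is `e`, the partial products are the vertices of the path. With the missed `R 2` in
    -- front these are 2m entries covering the group.
    partialProducts-unique : Unique (partialProducts (quotients path))
    partialProducts-unique = subst Unique
      (sym (scanl-quotients (R (+ 0)) (zigzag a↑ a↓ p tail-b)))
      (AllPairs.tail (covering⇒Unique _ path-cover (trans (cong suc length-path) (size p))))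
      where
      size : ∀ p → 6 + 8 * suc p ≡ 3 + 4 * suc p + (3 + 4 * suc p)
      size = solve-∀

-- From the steps of the path to the prescribed set.

module _ (p : ℕ) where

  private
    m : ℕ
    m = 3 + 4 * suc p

  open DihedralGroup m
  open GroupDefs group

  -- Together with `e` and `x`, a listing of `S` has 2m distinct entries and so exhausts the group.
  -- Hence `S` is the complement of `e` and `x`; so is the set of steps, because `x` is `x₀` for the
  -- multiplier `a`.
  complement-sequencing :
    ∀ a {b} → (b * a) % m ≡ 1 % m →
    (S : Pred (Dihedral m) 0ℓ) → e ∉ S → HasCardinality S (8 * suc p + 4) →
    ∀ {x} → x ≢ e → x ∉ S → x ≡ rot (((2 + p + p) * a) mod m) →
    ∃[ gs ] IsSequencing S gs
  complement-sequencing a {b} ba≡1 S e∉S (ss , (ss-unique , ∈ss⇔) , len) {x} x≢e x∉S refl =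
    quotients path , (gs-unique , λ g → mk⇔ (∈gs⇒∈S g) (∈S⇒∈gs g)) ,
    partialProducts-unique {b} ba≡1
    where
    open Construction p a hiding (m)
    open DihedralCoordinates m a using (quotients)

    unique : Unique (e ∷ x ∷ quotients path)
    unique = quotients-unique {b} ba≡1

    gs-unique : Unique (quotients path)
    gs-unique = AllPairs.tail (AllPairs.tail unique)

    exss-unique : Unique (e ∷ x ∷ ss)
    exss-unique =
      ((λ e≡x → x≢e (sym e≡x)) All.∷ ¬Any⇒All¬ ss (e∉S ∘ Equivalence.to (∈ss⇔ e))) ∷
      ¬Any⇒All¬ ss (x∉S ∘ Equivalence.to (∈ss⇔ x)) ∷ ss-unique

    size : ∀ p → 2 + (8 * suc p + 4) ≡ 3 + 4 * suc p + (3 + 4 * suc p)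
    size = solve-∀

    ∈gs⇒∈S : ∀ g → g ∈ˡ quotients path → g ∈ S
    ∈gs⇒∈S g g∈gs with Unique⇒covering exss-unique (trans (cong (suc ∘ suc) len) (size p)) g
    ... | here refl = contradiction (there g∈gs) (Unique[x∷xs]⇒x∉xs unique)
    ... | there (here refl) = contradiction g∈gs (Unique[x∷xs]⇒x∉xs (AllPairs.tail unique))
    ... | there (there g∈ss) = Equivalence.to (∈ss⇔ g) g∈ss

    ∈S⇒∈gs : ∀ g → g ∈ S → g ∈ˡ quotients path
    ∈S⇒∈gs g g∈S with quotients-cover {b} ba≡1 g
    ... | here refl = contradiction g∈S e∉S
    ... | there (here refl) = contradiction g∈S x∉S
    ... | there (there g∈gs) = g∈gs

-- Units modulo m and the choice of the multiplier.

inverse-mod : ∀ {a m} .{{_ : NonZero m}} → Coprime a m → ∃[ b ] (b * a) % m ≡ 1 % m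
inverse-mod {a} {m@(suc n)} coprime with coprime-Bézout coprime
... | Bézout.+- x y 1+ym≡xa = x , trans (cong (_% m) (sym 1+ym≡xa)) ([m+kn]%n≡m%n 1 y m)
-- Here `x * a` is -1 modulo `m`, so the inverse is the negative of `x`, written with `n` = m - 1.
... | Bézout.-+ x y 1+xa≡ym = x * n , (begin
  (x * n * a) % m                ≡⟨ [m+kn]%n≡m%n (x * n * a) y m ⟨
  (x * n * a + y * m) % m        ≡⟨ cong (λ k → (x * n * a + k) % m) 1+xa≡ym ⟨
  (x * n * a + (1 + x * a)) % m  ≡⟨ cong (_% m) (identity x n a) ⟩
  (1 + x * a * suc n) % m        ≡⟨ [m+kn]%n≡m%n 1 (x * a) m ⟩
  1 % m                          ∎)
  where
  open ≡-Reasoning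
  identity : ∀ x n a → x * n * a + (1 + x * a) ≡ 1 + x * a * suc n
  identity = solve-∀

-- A common divisor of `a` and `q * 3` is coprime to `q`, hence divides 3, and it is not 3.
coprime-*3 : ∀ {a q} → Coprime a q → ¬ 3 ∣ a → Coprime a (q * 3)
coprime-*3 {a} {q} coprime 3∤a {d} (d∣a , d∣q*3)
  with prime⇒irreducible (from-yes (prime? 3)) (coprime-divisor d⊥q d∣q*3)
  where
  d⊥q : Coprime d q
  d⊥q (e∣d , e∣q) = coprime (∣-trans e∣d d∣a , e∣q)
... | inj₁ d≡1 = d≡1
... | inj₂ refl = contradiction d∣a 3∤a

module _ (c t : ℕ) where

  q : ℕ
  q = 1 + 4 * c

  -- As 4c is - 1 modulo q, the multiplier 8ct is - 2t there, and it takes 2ℓ = 6c to 3t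
  -- modulo 3q.
  coprime-8ct : Coprime t q → Coprime (8 * c * t) q
  coprime-8ct coprime {d} (d∣8ct , d∣q) = coprime (d∣t , d∣q)
    where
    identity₁ : ∀ c t → 8 * c * t + 2 * t ≡ 2 * t * (1 + 4 * c)
    identity₁ = solve-∀

    identity₂ : ∀ c t → 2 * c * (2 * t) + t ≡ t * (1 + 4 * c)
    identity₂ = solve-∀

    d∣2t : d ∣ 2 * t
    d∣2t = ∣m+n∣m⇒∣n (subst (d ∣_) (sym (identity₁ c t)) (∣n⇒∣m*n (2 * t) d∣q)) d∣8ct

    d∣t : d ∣ t
    d∣t = ∣m+n∣m⇒∣n (subst (d ∣_) (sym (identity₂ c t)) (∣n⇒∣m*n t d∣q))
                     (∣n⇒∣m*n (2 * c) d∣2t)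

  -- Adding `q` preserves coprimality to `q`. If 3 divides `8 * c * t`, it does not divide `q`,
  -- being no common divisor, so adding `q` once removes the factor 3.
  coprime-multiplier : Coprime t q → ∃[ k ] Coprime (8 * c * t + k * q) (q * 3)
  coprime-multiplier coprime with 3 ∣? 8 * c * t
  ... | no 3∤ = 0 , subst (λ a → Coprime a (q * 3)) (sym (+-identityʳ (8 * c * t)))
                      (coprime-*3 (coprime-8ct coprime) 3∤)
  ... | yes 3∣ = 1 , coprime-*3 coprime′ 3∤
    where
    coprime′ : Coprime (8 * c * t + 1 * q) q
    coprime′ {d} (d∣ , d∣q) = coprime-8ct coprime
      (∣m+n∣m⇒∣n (subst (d ∣_) (+-comm (8 * c * t) (1 * q)) d∣) (∣n⇒∣m*n 1 d∣q) , d∣q)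

    3∤ : ¬ 3 ∣ 8 * c * t + 1 * q
    3∤ 3∣sum with () ← coprime-8ct coprime
      (3∣ , subst (3 ∣_) (*-identityˡ q) (∣m+n∣m⇒∣n 3∣sum 3∣))

-- Powers in the dihedral group.

module Powers (m : ℕ) .{{_ : NonZero m}} where

  open ModularArithmetic m
  open DihedralGroup m
  open GroupDefs group

  rot-^ : ∀ i k → rot i ^ k ≡ rot ((k * toℕ i) mod m)
  rot-^ i zero = refl
  rot-^ i (suc k) = trans (cong (rot i ·_) (rot-^ i k))
    (cong rot (trans (cong (_⊕ ((k * toℕ i) mod m)) (sym (mod-toℕ i)))
                     (mod-⊕ (toℕ i) (k * toℕ i))))

  ref-² : ∀ i → ref i ^ 2 ≡ e
  ref-² i = trans (cong (ref i ·_) (·-identityʳ (ref i))) (·-inverseˡ (ref i))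

  rot-^≡e⇒∣ : ∀ i k → rot i ^ k ≡ e → m ∣ k * toℕ i
  rot-^≡e⇒∣ i k eq = m%n≡0⇒n∣m (k * toℕ i) m (trans (sym (toℕ-mod (k * toℕ i)))
    (trans (cong toℕ (rot-injective (trans (sym (rot-^ i k)) eq)))
      (trans (toℕ-mod 0) (m*n%n≡0 0 m))))

  ∣⇒rot-^≡e : ∀ i k → m ∣ k * toℕ i → rot i ^ k ≡ e
  ∣⇒rot-^≡e i k m∣ki = trans (rot-^ i k)
    (cong rot (mod-cong {k * toℕ i} {0}
      (trans (n∣m⇒m%n≡0 (k * toℕ i) m m∣ki) (sym (m*n%n≡0 0 m)))))

-- Elements of order m / 3 and their multipliers.

module _ (c : ℕ) where

  private
    ℓ m : ℕ
    ℓ = suc c * 3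
    m = 3 + 4 * ℓ

    order : ℕ
    order = 1 + 4 * suc c

    m≡order*3 : m ≡ order * 3
    m≡order*3 = identity c
      where
      identity : ∀ c → 3 + 4 * (suc c * 3) ≡ (1 + 4 * suc c) * 3
      identity = solve-∀

  open ModularArithmetic m
  open DihedralGroup m
  open GroupDefs group
  open Powers m

  -- If `d` divides `t` and `order` is `q′ * d`, then `q′ * toℕ i` is a multiple of `q′ * d * 3`,
  -- which is `m`. So `x ^ q′` is `e`, and minimality of the order forces `d` to be 1.
  coprime-order : ∀ {x i t} → HasOrder x order → x ≡ rot i → toℕ i ≡ t * 3 →
                  Coprime t order
  coprime-order {i = i} {t} (_ , _ , minimal) refl i≡3t {d}
    (divides t′ t≡t′d , divides zero ())
  coprime-order {i = i} {t} (_ , _ , minimal) refl i≡3t {d}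
    (divides t′ t≡t′d , divides q′@(suc _) order≡q′d) = d≡1 d order≡q′d d≤1
    where
    open ≡-Reasoning

    identity : ∀ q′ t′ d → q′ * (t′ * d * 3) ≡ t′ * (q′ * d * 3)
    identity = solve-∀

    m∣q′i : m ∣ q′ * toℕ i
    m∣q′i = divides t′ (begin
      q′ * toℕ i         ≡⟨ cong (q′ *_) i≡3t ⟩
      q′ * (t * 3)       ≡⟨ cong (λ t → q′ * (t * 3)) t≡t′d ⟩
      q′ * (t′ * d * 3)  ≡⟨ identity q′ t′ d ⟩
      t′ * (q′ * d * 3)  ≡⟨ cong (λ n → t′ * (n * 3)) order≡q′d ⟨
      t′ * (order * 3)   ≡⟨ cong (t′ *_) m≡order*3 ⟨
      t′ * m             ∎)

    d≤1 : d ≤ 1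
    d≤1 = *-cancelˡ-≤ q′ (subst₂ _≤_ order≡q′d (sym (*-identityʳ q′))
      (minimal q′ z<s (∣⇒rot-^≡e i q′ m∣q′i)))

    d≡1 : ∀ d → order ≡ q′ * d → d ≤ 1 → d ≡ 1
    d≡1 zero order≡0 _ with () ← trans order≡0 (*-zeroʳ q′)
    d≡1 (suc zero) _ _ = refl
    d≡1 (suc (suc _)) _ (s≤s ())

  -- A reflection squares to `e`, while `order` is at least 5. For a rotation, `m` divides
  -- `order * toℕ i`, and cancelling `order` gives 3 as a divisor of the exponent; writing that as
  -- 3t, the multiplier is the one from `coprime-multiplier`.
  order⇒multiplier : ∀ {x} → HasOrder x order →
    ∃[ a ] ∃[ b ] ((b * a) % m ≡ 1 % m ×
                   x ≡ rot (((2 + (2 + c * 3) + (2 + c * 3)) * a) mod m))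
  order⇒multiplier {ref i} (_ , _ , minimal) with minimal 2 z<s (ref-² i)
  ... | s≤s (s≤s le) = contradiction (subst (_≤ 0) (+-suc c _) le) λ ()
  order⇒multiplier {rot i} x-order@(_ , x^q≡e , _)
    with divides t i≡3t ← *-cancelˡ-∣ order
           (subst (_∣ order * toℕ i) m≡order*3 (rot-^≡e⇒∣ i order x^q≡e))
    with k , coprime ← coprime-multiplier (suc c) t (coprime-order x-order refl i≡3t)
    with b , ba≡1 ← inverse-mod {m = m} (subst (Coprime _) (sym m≡order*3) coprime) =
    a , b , ba≡1 , cong rot (trans (sym (mod-toℕ i)) (mod-cong {toℕ i} {n * a} (begin
      toℕ i % m            ≡⟨ cong (_% m) i≡3t ⟩
      (t * 3) % m          ≡⟨ [m+kn]%n≡m%n (t * 3) s m ⟨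
      (t * 3 + s * m) % m  ≡⟨ cong (_% m) (identity c t k) ⟩
      (n * a) % m          ∎)))
    where
    open ≡-Reasoning

    n s a : ℕ
    n = 2 + (2 + c * 3) + (2 + c * 3)
    -- With C = c + 1, `n` is 6C and `order` is 4C + 1. The first summand comes from 16C² - 1 = (4C
    -- - 1)(4C + 1), the second from the term of `a` with `k`.
    s = t * (4 * c + 3) + 2 * suc c * k
    a = 8 * suc c * t + k * (1 + 4 * suc c)

    identity : ∀ c t k →
      t * 3 + (t * (4 * c + 3) + 2 * suc c * k) * (3 + 4 * (suc c * 3)) ≡
      (2 + (2 + c * 3) + (2 + c * 3)) * (8 * suc c * t + k * (1 + 4 * suc c))
    identity = solve-∀

  HasOrder-m/3 : ∀ {x} → HasOrder x (m / 3) → HasOrder x order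
  HasOrder-m/3 = subst (HasOrder _) (trans (cong (_/ 3) m≡order*3) (m*n/n≡m order 3))

theorem5p9 : (ℓ : ℕ) → 3 ∣ ℓ → ¬ (2 ∣ ℓ) →
    let D = DihedralGroup.group (3 + 4 * ℓ)
        open Group D using (Carrier) renaming (ε to e)
        open GroupDefs D
    in
    (S : Pred Carrier 0ℓ) → e ∉ S → HasCardinality S (8 * ℓ + 4) →
    (x : Carrier) → x ≢ e → x ∉ S → HasOrder x ((3 + 4 * ℓ) / 3) →
    ∃[ gs ] IsSequencing S gs
-- Oddness rules out ℓ = 0.
theorem5p9 _ (divides zero refl) 2∤ℓ = contradiction (divides 0 refl) 2∤ℓ
theorem5p9 _ (divides (suc c) refl) _ S e∉S card x x≢e x∉S x-order
  with a , b , ba≡1 , x≡ ← order⇒multiplier c (HasOrder-m/3 c x-order) =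
  -- Here ℓ is `suc c * 3`, so p = ℓ - 1 is `2 + c * 3`.
  complement-sequencing (2 + c * 3) a {b} ba≡1 S e∉S card x≢e x∉S x≡
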